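{- Let $A$ and $B$ be two $m\times m$ coloring matrices. If $A$ and $B$ are tree coloring equivalent, then the sum of all entries of $A^TA+A^2$ equals the sum of all entries of $B^TB+B^2$.
   Context: A plane tree is an unlabeled rooted tree in which the children of every vertex are linearly ordered. A coloring matrix is an $m\times m$ matrix $A=(a_{ij})$ with entries in $\{0,1\}$. An $A$-coloring of a plane tree assigns to each vertex a color in $\{1,\dots,m\}$ such that whenever a vertex of color $j$ is a child of a vertex of color $i$, $a_{ij}=1$. Let $t_A(n)$ be the number of pairs (plane tree with $n$ vertices, $A$-coloring of it). Two $m\times m$ coloring matrices $A,B$ are tree coloring equivalent if $t_A(n)=t_B(n)$ for all $n\ge1$. -}

module Defs where

open import Algebra.Properties.Semiring.Sum using (sum)
open import Data.Fin.Base using (Fin)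
open import Data.List.Base using (List; []; _∷_; map; concatMap; cartesianProductWith; filter; length; upTo; allFin)
open import Data.List.Membership.Propositional using (_∈_; find; lose)
open import Data.List.Membership.Propositional.Properties using (∈-map⁺; ∈-map⁻; ∈-concatMap⁺; ∈-concatMap⁻; ∈-cartesianProductWith⁺; ∈-cartesianProductWith⁻; ∈-upTo⁺; ∈-upTo⁻; ∈-filter⁺; ∈-filter⁻; ∈-allFin)
open import Data.List.Relation.Unary.All using (All; []; _∷_)
import Data.List.Relation.Unary.All as All
open import Data.List.Relation.Binary.Disjoint.Propositional using (Disjoint)
open import Data.List.Relation.Unary.All.Properties using () renaming (map⁺ to All-map⁺)
import Data.List.Relation.Unary.AllPairs as AllPairs
open import Data.List.Relation.Unary.AllPairs.Properties using () renaming (map⁺ to AllPairs-map⁺)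
open import Data.List.Relation.Unary.Any using (here)
open import Data.List.Relation.Unary.Unique.Propositional using (Unique)
import Data.List.Relation.Unary.Unique.Propositional.Properties as Unique
open import Data.Nat.Base using (ℕ; zero; suc; _+_; _*_; _∸_; _≤_; s≤s)
open import Data.Nat.Properties using (_≟_; +-*-semiring; m≤m+n; m≤n+m; m+n∸m≡n; m+[n∸m]≡n; ≤-trans; ≤-refl)
open import Data.Product.Base using (Σ; _×_; _,_; proj₁; proj₂)
open import Data.Sum.Base using (_⊎_)
open import Data.Unit.Base using (⊤; tt)
open import Function.Bundles using (_⇔_; mk⇔)
open import Relation.Binary.PropositionalEquality using (_≡_; _≢_; refl; sym; trans; cong; subst)
open import Relation.Nullary using (Dec; yes)
open import Relation.Nullary.Decidable using (_×-dec_)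

Matrix : ℕ → Set
Matrix m = Fin m → Fin m → ℕ

infixl 6 _⊕_
infixl 7 _⊗_
infix  8 _ᵀ

_⊕_ : ∀ {m} → Matrix m → Matrix m → Matrix m
(M ⊕ N) i j = M i j + N i j

_⊗_ : ∀ {m} → Matrix m → Matrix m → Matrix m
(M ⊗ N) i j = sum +-*-semiring (λ k → M i k * N k j)

_ᵀ : ∀ {m} → Matrix m → Matrix m
(M ᵀ) i j = M j i

entrySum : ∀ {m} → Matrix m → ℕ
entrySum M = sum +-*-semiring (λ i → sum +-*-semiring (λ j → M i j))

record ColoringMatrix (m : ℕ) : Set where
  field
    entry  : Matrix m
    binary : ∀ i j → entry i j ≡ 0 ⊎ entry i j ≡ 1

open ColoringMatrix public

data PlaneTree : Set where
  node : List PlaneTree → PlaneTree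

mutual
  size : PlaneTree → ℕ
  size (node ts) = suc (forestSize ts)

  forestSize : List PlaneTree → ℕ
  forestSize []       = 0
  forestSize (t ∷ ts) = size t + forestSize ts

-- An assignment of a color to every vertex of a plane tree: a color for the
-- root, and recursively an assignment on each child subtree.
data Assignment (m : ℕ) : PlaneTree → Set where
  node : ∀ {ts} → Fin m → All (Assignment m) ts → Assignment m (node ts)

rootColor : ∀ {m t} → Assignment m t → Fin m
rootColor (node i _) = i

module _ {m : ℕ} (A : ColoringMatrix m) where
  mutual
    IsColoring : ∀ {t} → Assignment m t → Set
    IsColoring (node i cs) = AreChildColorings i cs

    -- cs are the assignments on the child subtrees of a vertex of color i.
    AreChildColorings : ∀ {ts} → Fin m → All (Assignment m) ts → Set
    AreChildColorings i []       = ⊤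
    AreChildColorings i (c ∷ cs) =
      entry A i (rootColor c) ≡ 1 × IsColoring c × AreChildColorings i cs

  mutual
    isColoring? : ∀ {t} (c : Assignment m t) → Dec (IsColoring c)
    isColoring? (node i cs) = areChildColorings? i cs

    areChildColorings? : ∀ {ts} i (cs : All (Assignment m) ts) →
                         Dec (AreChildColorings i cs)
    areChildColorings? i []       = yes tt
    areChildColorings? i (c ∷ cs) =
      (entry A i (rootColor c) ≟ 1) ×-dec
      (isColoring? c ×-dec areChildColorings? i cs)

-- For n ≤ d, forests d n lists the forests with n vertices in total; d only
-- bounds the recursion. A nonempty forest is split into the child forest
-- (k vertices) of its first root, and the remaining trees.
forests : (d n : ℕ) → List (List PlaneTree)
forests d       zero    = [] ∷ []
forests zero    (suc n) = []
forests (suc d) (suc n) = concatMap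
  (λ k → cartesianProductWith (λ ts us → node ts ∷ us) (forests d k) (forests d (n ∸ k)))
  (upTo (suc n))

planeTrees : ℕ → List PlaneTree
planeTrees zero    = []
planeTrees (suc n) = map node (forests n n)

mutual
  assignments : ∀ m t → List (Assignment m t)
  assignments m (node ts) =
    cartesianProductWith node (allFin m) (forestAssignments m ts)

  forestAssignments : ∀ m ts → List (All (Assignment m) ts)
  forestAssignments m []       = [] ∷ []
  forestAssignments m (t ∷ ts) =
    cartesianProductWith _∷_ (assignments m t) (forestAssignments m ts)

coloredTrees : ∀ {m} → ColoringMatrix m → ℕ → List (Σ PlaneTree (Assignment m))
coloredTrees {m} A n = filter (λ (_ , c) → isColoring? A c)
  (concatMap (λ t → map (t ,_) (assignments m t)) (planeTrees n))

-- t_A(n); see coloredTrees-unique and ∈-coloredTrees below.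
treeColorings : ∀ {m} → ColoringMatrix m → ℕ → ℕ
treeColorings A n = length (coloredTrees A n)

TreeColoringEquivalent : ∀ {m} → ColoringMatrix m → ColoringMatrix m → Set
TreeColoringEquivalent A B = ∀ n → 1 ≤ n → treeColorings A n ≡ treeColorings B n

-- The list coloredTrees A n contains each pair (plane tree with n vertices,
-- A-coloring of it) exactly once, so its length is the number of such pairs.

private
  concatMap-unique : ∀ {X Y : Set} (f : X → List Y) (g : Y → X) →
    (∀ x {y} → y ∈ f x → g y ≡ x) → (∀ x → Unique (f x)) →
    ∀ {xs} → Unique xs → Unique (concatMap f xs)
  concatMap-unique f g inv uf {xs} uxs = Unique.concat⁺
    (All-map⁺ (All.universal uf xs))
    (AllPairs-map⁺ (AllPairs.map disjoint uxs))
    where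
    disjoint : ∀ {x y} → x ≢ y → Disjoint (f x) (f y)
    disjoint x≢y (p , q) = x≢y (trans (sym (inv _ p)) (inv _ q))

  forests-sound : ∀ d n {ts} → ts ∈ forests d n → forestSize ts ≡ n
  forests-sound d zero (here refl) = refl
  forests-sound (suc d) (suc n) p
    with k , k∈ , q ← find (∈-concatMap⁻ _ {xs = upTo (suc n)} p)
    with ts , us , ts∈ , us∈ , refl ←
           ∈-cartesianProductWith⁻ _ (forests d k) (forests d (n ∸ k)) q
    with s≤s k≤n ← ∈-upTo⁻ k∈
    rewrite forests-sound d k ts∈ | forests-sound d (n ∸ k) us∈
    = cong suc (m+[n∸m]≡n k≤n)

  forests-complete : ∀ d ts → forestSize ts ≤ d → ts ∈ forests d (forestSize ts)
  forests-complete d [] _ = here refl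
  forests-complete (suc d) (node ts ∷ us) (s≤s le) =
    ∈-concatMap⁺ _ (lose (∈-upTo⁺ (s≤s (m≤m+n a b)))
      (∈-cartesianProductWith⁺ _
        (forests-complete d ts (≤-trans (m≤m+n a b) le))
        (subst (λ k → us ∈ forests d k) (sym (m+n∸m≡n a b))
          (forests-complete d us (≤-trans (m≤n+m b a) le)))))
    where
    a = forestSize ts
    b = forestSize us

  firstChildForestSize : List PlaneTree → ℕ
  firstChildForestSize []            = 0
  firstChildForestSize (node ts ∷ _) = forestSize ts

  forests-unique : ∀ d n → Unique (forests d n)
  forests-unique d       zero    = [] AllPairs.∷ AllPairs.[]
  forests-unique zero    (suc n) = AllPairs.[]
  forests-unique (suc d) (suc n) = concatMap-unique _ firstChildForestSize
    inv
    (λ k → Unique.cartesianProductWith⁺ _ (λ { refl → refl , refl })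
             (forests-unique d k) (forests-unique d (n ∸ k)))
    (Unique.upTo⁺ (suc n))
    where
    inv : ∀ k {ts} → ts ∈ cartesianProductWith (λ ts us → node ts ∷ us) (forests d k) (forests d (n ∸ k)) →
          firstChildForestSize ts ≡ k
    inv k p with _ , _ , ts∈ , _ , refl ←
                 ∈-cartesianProductWith⁻ _ (forests d k) (forests d (n ∸ k)) p
      = forests-sound d k ts∈

  planeTrees-sound : ∀ n {t} → t ∈ planeTrees n → size t ≡ n
  planeTrees-sound (suc n) p with _ , q , refl ← ∈-map⁻ node p =
    cong suc (forests-sound n n q)

  planeTrees-complete : ∀ t → t ∈ planeTrees (size t)
  planeTrees-complete (node ts) = ∈-map⁺ node (forests-complete _ ts ≤-refl)

  planeTrees-unique : ∀ n → Unique (planeTrees n)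
  planeTrees-unique zero    = AllPairs.[]
  planeTrees-unique (suc n) = Unique.map⁺ (λ { refl → refl }) (forests-unique n n)

  mutual
    assignments-complete : ∀ {m t} (c : Assignment m t) → c ∈ assignments m t
    assignments-complete (node i cs) =
      ∈-cartesianProductWith⁺ node (∈-allFin i) (forestAssignments-complete cs)

    forestAssignments-complete : ∀ {m ts} (cs : All (Assignment m) ts) →
                                 cs ∈ forestAssignments m ts
    forestAssignments-complete []       = here refl
    forestAssignments-complete (c ∷ cs) = ∈-cartesianProductWith⁺ _∷_
      (assignments-complete c) (forestAssignments-complete cs)

  mutual
    assignments-unique : ∀ m t → Unique (assignments m t)
    assignments-unique m (node ts) = Unique.cartesianProductWith⁺ node
      (λ { refl → refl , refl }) (Unique.allFin⁺ m) (forestAssignments-unique m ts)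

    forestAssignments-unique : ∀ m ts → Unique (forestAssignments m ts)
    forestAssignments-unique m []       = [] AllPairs.∷ AllPairs.[]
    forestAssignments-unique m (t ∷ ts) = Unique.cartesianProductWith⁺ _∷_
      (λ { refl → refl , refl }) (assignments-unique m t) (forestAssignments-unique m ts)

coloredTrees-unique : ∀ {m} (A : ColoringMatrix m) n → Unique (coloredTrees A n)
coloredTrees-unique {m} A n = Unique.filter⁺ _ (concatMap-unique _ proj₁
  inv
  (λ t → Unique.map⁺ (λ { refl → refl }) (assignments-unique m t))
  (planeTrees-unique n))
  where
  inv : ∀ t {x : Σ PlaneTree (Assignment m)} → x ∈ map (t ,_) (assignments m t) → proj₁ x ≡ t
  inv t p with _ , _ , refl ← ∈-map⁻ (t ,_) p = refl

∈-coloredTrees : ∀ {m} (A : ColoringMatrix m) n {t} (c : Assignment m t) →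
                 (t , c) ∈ coloredTrees A n ⇔ (size t ≡ n × IsColoring A c)
∈-coloredTrees {m} A n {t} c = mk⇔ to from
  where
  to : (t , c) ∈ coloredTrees A n → size t ≡ n × IsColoring A c
  to p
    with q , col ← ∈-filter⁻ (λ (_ , c) → isColoring? A c)
           {xs = concatMap (λ t → map (t ,_) (assignments m t)) (planeTrees n)} p
    with u , u∈ , r ← find (∈-concatMap⁻ _ {xs = planeTrees n} q)
    with _ , _ , refl ← ∈-map⁻ (u ,_) r
    = planeTrees-sound n u∈ , col

  from : size t ≡ n × IsColoring A c → (t , c) ∈ coloredTrees A n
  from (refl , col) = ∈-filter⁺ _
    (∈-concatMap⁺ _ (lose (planeTrees-complete t) (∈-map⁺ (t ,_) (assignments-complete c))))
    col

{-# OPTIONS --safe #-}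

-- There are two plane trees with 3 vertices. The path has one coloring for
-- each walk i → j → k, in total the entry sum of A². The cherry has, for each
-- root color k, one coloring for each pair (i , j) with a_ki = a_kj = 1, in
-- total the entry sum of AᵀA. Hence t_A(3) is exactly the entry sum of AᵀA + A².

module Submission where

open import Defs
open import Data.Bool.Base using (Bool; true; false; _∧_)
open import Data.Fin.Base using (Fin; zero; suc)
open import Data.List.Base using (List; []; _∷_; _++_; map; concatMap; cartesianProductWith; filter; length; tabulate; allFin)
open import Data.List.Properties using (map-++; map-∘; map-cong; map-tabulate)
open import Data.List.Relation.Unary.All using (All; []; _∷_)
open import Data.Nat.Base using (ℕ; zero; suc; _+_; _*_; s≤s; z≤n)
import Data.Nat.ListAction as ListAction
open import Data.Nat.ListAction.Properties using (sum-++)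
open import Data.Nat.Properties using (_≟_; +-*-semiring; +-identityʳ; *-identityʳ; *-zeroʳ; *-assoc; *-distribˡ-+; *-distribʳ-+)
open import Data.Product.Base using (Σ; _,_)
open import Data.Sum.Base using (_⊎_; inj₁; inj₂)
open import Function.Base using (id; _∘_)
open import Level using (0ℓ)
open import Relation.Binary.PropositionalEquality using (_≡_; _≗_; refl; sym; trans; cong; cong₂; module ≡-Reasoning)
open import Relation.Nullary using (does)
open import Relation.Unary using (Pred; Decidable)

open import Algebra.Properties.Semiring.Sum +-*-semiring using (sum-syntax; sum-cong-≗; ∑-comm; ∑-distrib-+; *-distribˡ-sum; *-distribʳ-sum)
open ≡-Reasoning

private
  variable
    X Y Z : Set

𝟙 : Bool → ℕ
𝟙 true  = 1
𝟙 false = 0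

𝟙-∧ : ∀ a b → 𝟙 (a ∧ b) ≡ 𝟙 a * 𝟙 b
𝟙-∧ true  b = sym (+-identityʳ (𝟙 b))
𝟙-∧ false b = refl

-- Both values of a binary entry are checked directly. This turns the yes/no condition on an edge
-- into the matrix entry itself, so that counts become polynomials in the entries.
𝟙-≟1 : ∀ {a} → a ≡ 0 ⊎ a ≡ 1 → 𝟙 (does (a ≟ 1)) ≡ a
𝟙-≟1 (inj₁ refl) = refl
𝟙-≟1 (inj₂ refl) = refl

sumOver : (X → ℕ) → List X → ℕ
sumOver f xs = ListAction.sum (map f xs)

sumOver-cong : {f g : X → ℕ} → f ≗ g → sumOver f ≗ sumOver g
sumOver-cong f≗g xs = cong ListAction.sum (map-cong f≗g xs)

sumOver-++ : (f : X → ℕ) (xs ys : List X) →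
             sumOver f (xs ++ ys) ≡ sumOver f xs + sumOver f ys
sumOver-++ f xs ys =
  trans (cong ListAction.sum (map-++ f xs ys)) (sum-++ (map f xs) (map f ys))

sumOver-map : (f : Y → ℕ) (g : X → Y) (xs : List X) →
              sumOver f (map g xs) ≡ sumOver (f ∘ g) xs
sumOver-map f g xs = cong ListAction.sum (sym (map-∘ xs))

sumOver-concatMap : (f : Y → ℕ) (g : X → List Y) (xs : List X) →
                    sumOver f (concatMap g xs) ≡ sumOver (sumOver f ∘ g) xs
sumOver-concatMap f g []       = refl
sumOver-concatMap f g (x ∷ xs) =
  trans (sumOver-++ f (g x) _) (cong (sumOver f (g x) +_) (sumOver-concatMap f g xs))

sumOver-cartesianProductWith : (h : Z → ℕ) (f : X → Y → Z) (xs : List X) (ys : List Y) →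
  sumOver h (cartesianProductWith f xs ys) ≡ sumOver (λ x → sumOver (h ∘ f x) ys) xs
sumOver-cartesianProductWith h f []       ys = refl
sumOver-cartesianProductWith h f (x ∷ xs) ys =
  trans (sumOver-++ h (map (f x) ys) _)
        (cong₂ _+_ (sumOver-map h (f x) ys) (sumOver-cartesianProductWith h f xs ys))

sumOver-*ˡ : (a : ℕ) (f : X → ℕ) (xs : List X) → sumOver (λ x → a * f x) xs ≡ a * sumOver f xs
sumOver-*ˡ a f []       = sym (*-zeroʳ a)
sumOver-*ˡ a f (x ∷ xs) =
  trans (cong (a * f x +_) (sumOver-*ˡ a f xs)) (sym (*-distribˡ-+ a (f x) _))

sumOver-*ʳ : (a : ℕ) (f : X → ℕ) (xs : List X) → sumOver (λ x → f x * a) xs ≡ sumOver f xs * a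
sumOver-*ʳ a f []       = refl
sumOver-*ʳ a f (x ∷ xs) =
  trans (cong (f x * a +_) (sumOver-*ʳ a f xs)) (sym (*-distribʳ-+ a (f x) _))

-- Trades a count for a sum of indicators over the unfiltered list. Such a sum can be split along
-- concatenations and cartesian products.
length-filter≡sumOver : {P : Pred X 0ℓ} (P? : Decidable P) (xs : List X) →
                        length (filter P? xs) ≡ sumOver (λ x → 𝟙 (does (P? x))) xs
length-filter≡sumOver P? []       = refl
length-filter≡sumOver P? (x ∷ xs) with does (P? x)
... | true  = cong suc (length-filter≡sumOver P? xs)
... | false = length-filter≡sumOver P? xs

sum-tabulate : ∀ {n} (f : Fin n → ℕ) → ListAction.sum (tabulate f) ≡ ∑[ i < n ] f i
sum-tabulate {zero}  f = refl
sum-tabulate {suc n} f = cong (f zero +_) (sum-tabulate (f ∘ suc))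

-- The bridge between the two kinds of sum: list sums range over the enumerations of trees and
-- assignments, while `∑` ranges over colors, where summations can be interchanged.
sumOver-allFin : ∀ {n} (f : Fin n → ℕ) → sumOver f (allFin n) ≡ ∑[ i < n ] f i
sumOver-allFin f = trans (cong ListAction.sum (map-tabulate id f)) (sum-tabulate f)

leaf path cherry : PlaneTree
leaf   = node []
path   = node (node (leaf ∷ []) ∷ [])
cherry = node (leaf ∷ leaf ∷ [])

module _ {m : ℕ} (A : ColoringMatrix m) where

  private
    a : Matrix m
    a = entry A

  mutual
    -- The product of the entries `a i j` over all edges, with `i` the color of the parent and `j`
    -- that of the child.
    weight : ∀ {t} → Assignment m t → ℕ
    weight (node i cs) = childrenWeight i cs

    childrenWeight : ∀ {ts} → Fin m → All (Assignment m) ts → ℕ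
    childrenWeight i []       = 1
    childrenWeight i (c ∷ cs) = a i (rootColor c) * weight c * childrenWeight i cs

  mutual
    𝟙-isColoring : ∀ {t} (c : Assignment m t) → 𝟙 (does (isColoring? A c)) ≡ weight c
    𝟙-isColoring (node i cs) = 𝟙-areChildColorings i cs

    𝟙-areChildColorings : ∀ {ts} i (cs : All (Assignment m) ts) →
                          𝟙 (does (areChildColorings? A i cs)) ≡ childrenWeight i cs
    𝟙-areChildColorings i []       = refl
    𝟙-areChildColorings i (c ∷ cs) = begin
      𝟙 (p ∧ (q ∧ r))       ≡⟨ 𝟙-∧ p (q ∧ r) ⟩
      𝟙 p * 𝟙 (q ∧ r)       ≡⟨ cong (𝟙 p *_) (𝟙-∧ q r) ⟩
      -- The decision procedure nests its conjunctions to the right, whereas the product in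
      -- `childrenWeight` associates to the left.
      𝟙 p * (𝟙 q * 𝟙 r)     ≡⟨ *-assoc (𝟙 p) (𝟙 q) (𝟙 r) ⟨
      𝟙 p * 𝟙 q * 𝟙 r       ≡⟨ cong₂ _*_ (cong₂ _*_ (𝟙-≟1 (binary A i (rootColor c))) (𝟙-isColoring c))
                                         (𝟙-areChildColorings i cs) ⟩
      childrenWeight i (c ∷ cs) ∎
      where
      p = does (a i (rootColor c) ≟ 1)
      q = does (isColoring? A c)
      r = does (areChildColorings? A i cs)

  -- The number of ways to color the forest below a parent of color `i`, computed as a
  -- transfer-matrix recursion: each first tree contributes a sum over its root color `j`.
  forestColorings : List PlaneTree → Fin m → ℕ
  forestColorings []             i = 1
  forestColorings (node us ∷ ts) i =
    (∑[ j < m ] (a i j * forestColorings us j)) * forestColorings ts i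

  -- Once the color of the parent is fixed, the subtrees of its children are colored independently,
  -- so the sum over the product list factors.
  sum-childrenWeight : ∀ ts i →
    sumOver (childrenWeight i) (forestAssignments m ts) ≡ forestColorings ts i
  sum-childrenWeight []             i = refl
  sum-childrenWeight (node us ∷ ts) i = begin
    sumOver (childrenWeight i) (forestAssignments m (node us ∷ ts))
      ≡⟨ sumOver-cartesianProductWith _ _∷_ (assignments m (node us)) (forestAssignments m ts) ⟩
    sumOver (λ c → sumOver (λ cs → a i (rootColor c) * weight c * childrenWeight i cs) (forestAssignments m ts)) (assignments m (node us))
      ≡⟨ sumOver-cong (λ c → sumOver-*ˡ (a i (rootColor c) * weight c) (childrenWeight i) (forestAssignments m ts)) (assignments m (node us)) ⟩
    sumOver (λ c → a i (rootColor c) * weight c * sumOver (childrenWeight i) (forestAssignments m ts)) (assignments m (node us))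
      ≡⟨ sumOver-*ʳ _ (λ c → a i (rootColor c) * weight c) (assignments m (node us)) ⟩
    sumOver (λ c → a i (rootColor c) * weight c) (assignments m (node us)) * sumOver (childrenWeight i) (forestAssignments m ts)
      ≡⟨ cong₂ _*_ firstTree (sum-childrenWeight ts i) ⟩
    forestColorings (node us ∷ ts) i ∎
    where
    -- An assignment on `node us` is a root color `j` with an assignment on `us`. The edge factor
    -- `a i j` depends on `j` alone and leaves the inner sum.
    firstTree : sumOver (λ c → a i (rootColor c) * weight c) (assignments m (node us))
              ≡ ∑[ j < m ] (a i j * forestColorings us j)
    firstTree = begin
      sumOver (λ c → a i (rootColor c) * weight c) (assignments m (node us))
        ≡⟨ sumOver-cartesianProductWith _ node (allFin m) (forestAssignments m us) ⟩
      sumOver (λ j → sumOver (λ cs → a i j * childrenWeight j cs) (forestAssignments m us)) (allFin m)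
        ≡⟨ sumOver-allFin (λ j → sumOver (λ cs → a i j * childrenWeight j cs) (forestAssignments m us)) ⟩
      ∑[ j < m ] sumOver (λ cs → a i j * childrenWeight j cs) (forestAssignments m us)
        ≡⟨ sum-cong-≗ (λ j → trans (sumOver-*ˡ (a i j) (childrenWeight j) (forestAssignments m us))
                                   (cong (a i j *_) (sum-childrenWeight us j))) ⟩
      ∑[ j < m ] (a i j * forestColorings us j) ∎

  -- No edge lies above the root, so its color is summed without a matrix entry.
  colorings : PlaneTree → ℕ
  colorings (node ts) = ∑[ i < m ] forestColorings ts i

  sum-weight : ∀ t → sumOver weight (assignments m t) ≡ colorings t
  sum-weight (node ts) = begin
    sumOver weight (assignments m (node ts))
      ≡⟨ sumOver-cartesianProductWith weight node (allFin m) (forestAssignments m ts) ⟩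
    sumOver (λ i → sumOver (childrenWeight i) (forestAssignments m ts)) (allFin m)
      ≡⟨ sumOver-cong (sum-childrenWeight ts) (allFin m) ⟩
    sumOver (forestColorings ts) (allFin m)
      ≡⟨ sumOver-allFin (forestColorings ts) ⟩
    colorings (node ts) ∎

  treeColorings≡ : ∀ n → treeColorings A n ≡ sumOver colorings (planeTrees n)
  treeColorings≡ n = begin
    treeColorings A n
      ≡⟨ length-filter≡sumOver (λ (_ , c) → isColoring? A c) (concatMap colored (planeTrees n)) ⟩
    sumOver (λ (_ , c) → 𝟙 (does (isColoring? A c))) (concatMap colored (planeTrees n))
      ≡⟨ sumOver-cong (λ (_ , c) → 𝟙-isColoring c) (concatMap colored (planeTrees n)) ⟩
    sumOver pairWeight (concatMap colored (planeTrees n))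
      ≡⟨ sumOver-concatMap pairWeight colored (planeTrees n) ⟩
    sumOver (λ t → sumOver pairWeight (map (t ,_) (assignments m t))) (planeTrees n)
      ≡⟨ sumOver-cong (λ t → trans (sumOver-map pairWeight (t ,_) (assignments m t)) (sum-weight t)) (planeTrees n) ⟩
    sumOver colorings (planeTrees n) ∎
    where
    colored : PlaneTree → List (Σ PlaneTree (Assignment m))
    colored t = map (t ,_) (assignments m t)

    pairWeight : Σ PlaneTree (Assignment m) → ℕ
    pairWeight (_ , c) = weight c

  rowSum : Fin m → ℕ
  rowSum i = ∑[ j < m ] a i j

  -- A leaf has exactly one coloring of its empty child forest, so only the entries of row `i`
  -- remain in its factor.
  forestColorings-leaf : ∀ ts i → forestColorings (leaf ∷ ts) i ≡ rowSum i * forestColorings ts i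
  forestColorings-leaf ts i =
    cong (_* forestColorings ts i) (sum-cong-≗ (λ j → *-identityʳ (a i j)))

  colorings-cherry : colorings cherry ≡ entrySum (a ᵀ ⊗ a)
  colorings-cherry = begin
    ∑[ k < m ] forestColorings (leaf ∷ leaf ∷ []) k
      ≡⟨ sum-cong-≗ (λ k → trans (forestColorings-leaf (leaf ∷ []) k)
           (cong (rowSum k *_) (trans (forestColorings-leaf [] k) (*-identityʳ (rowSum k))))) ⟩
    ∑[ k < m ] (rowSum k * rowSum k)
      ≡⟨ sum-cong-≗ (λ k → trans (*-distribʳ-sum (rowSum k) (a k))
           (sum-cong-≗ (λ i → *-distribˡ-sum (a k i) (a k)))) ⟩
    ∑[ k < m ] ∑[ i < m ] ∑[ j < m ] (a k i * a k j)
      -- The root color `k` is the summation index inside the matrix product. Two interchanges carry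
      -- it from the outermost to the innermost position.
      ≡⟨ ∑-comm (λ k i → ∑[ j < m ] (a k i * a k j)) ⟩
    ∑[ i < m ] ∑[ k < m ] ∑[ j < m ] (a k i * a k j)
      ≡⟨ sum-cong-≗ (λ i → ∑-comm (λ k j → a k i * a k j)) ⟩
    entrySum (a ᵀ ⊗ a) ∎

  colorings-path : colorings path ≡ entrySum (a ⊗ a)
  colorings-path = begin
    -- The factor 1 comes from the empty forest to the right of the only child of the root.
    ∑[ i < m ] ((∑[ k < m ] (a i k * forestColorings (leaf ∷ []) k)) * 1)
      ≡⟨ sum-cong-≗ (λ i → trans (*-identityʳ _) (sum-cong-≗ (λ k → cong (a i k *_)
           (trans (forestColorings-leaf [] k) (*-identityʳ (rowSum k)))))) ⟩
    ∑[ i < m ] ∑[ k < m ] (a i k * rowSum k)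
      ≡⟨ sum-cong-≗ (λ i → sum-cong-≗ (λ k → *-distribˡ-sum (a i k) (a k))) ⟩
    ∑[ i < m ] ∑[ k < m ] ∑[ j < m ] (a i k * a k j)
      -- Here the middle vertex has color `k`, so one interchange with `j` puts it innermost.
      ≡⟨ sum-cong-≗ (λ i → ∑-comm (λ k j → a i k * a k j)) ⟩
    entrySum (a ⊗ a) ∎

entrySum-⊕ : ∀ {m} (M N : Matrix m) → entrySum (M ⊕ N) ≡ entrySum M + entrySum N
entrySum-⊕ {m} M N =
  trans (sum-cong-≗ (λ i → ∑-distrib-+ (M i) (N i)))
        (∑-distrib-+ (λ i → ∑[ j < m ] M i j) (λ i → ∑[ j < m ] N i j))

treeColorings-3 : ∀ {m} (A : ColoringMatrix m) →
                  treeColorings A 3 ≡ entrySum (entry A ᵀ ⊗ entry A ⊕ entry A ⊗ entry A)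
treeColorings-3 A = begin
  treeColorings A 3
    ≡⟨ treeColorings≡ A 3 ⟩
  -- `planeTrees 3` evaluates to `cherry` followed by `path`; the 0 is the sum over the empty rest
  -- of the list.
  colorings A cherry + (colorings A path + 0)
    ≡⟨ cong₂ _+_ (colorings-cherry A) (trans (+-identityʳ _) (colorings-path A)) ⟩
  entrySum (entry A ᵀ ⊗ entry A) + entrySum (entry A ⊗ entry A)
    ≡⟨ entrySum-⊕ (entry A ᵀ ⊗ entry A) (entry A ⊗ entry A) ⟨
  entrySum (entry A ᵀ ⊗ entry A ⊕ entry A ⊗ entry A) ∎

theorem11 : (m : ℕ) (A B : ColoringMatrix m) → TreeColoringEquivalent A B →
    entrySum (entry A ᵀ ⊗ entry A ⊕ entry A ⊗ entry A) ≡ entrySum (entry B ᵀ ⊗ entry B ⊕ entry B ⊗ entry B)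
theorem11 m A B A~B =
  trans (sym (treeColorings-3 A)) (trans (A~B 3 (s≤s z≤n)) (treeColorings-3 B))
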